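{- There exists a universal constant $c>0$ such that for every integer $k\ge 1$, with $n = 2^k$, the $2^k\times 2^k$ discrete Haar basis matrix $A_k$ satisfies $$\mathrm{hervecdisc}(A_k) \ge c\,\sqrt{\log n}\cdot \mathrm{detlb}(A_k).$$
   Context: The discrete Haar basis matrices $A_k\in\{ -1,0,1\}^{2^k\times 2^k}$ are defined recursively by $A_0=[1]$ and $$A_k=\begin{bmatrix}A_{k-1} & I_{2^{k-1}}\\ A_{k-1} & -I_{2^{k-1}}\end{bmatrix},\quad k\ge1,$$ where $I_{2^{k-1}}$ is the $2^{k-1}\times 2^{k-1}$ identity matrix. For a real $m\times n$ matrix $A$, the vector discrepancy is $$\mathrm{vecdisc}(A)=\min_{v_1,\dots,v_n\in S^{n-1}}\max_{j\in[m]}\Big\|\sum_{i=1}^n A_{j,i}v_i\Big\|_2,$$ where $S^{n-1}$ is the unit sphere of $\mathbb{R}^n$. The hereditary vector discrepancy $\mathrm{hervecdisc}(A)$ is the maximum of $\mathrm{vecdisc}(B)$ over all submatrices $B$ consisting of a nonempty subset of the columns of $A$. The determinant lower bound is $\mathrm{detlb}(A) = \max_{\ell}\max_{B}|\det(B)|^{1/\ell}$, where $\ell$ ranges over $1\le \ell\le \min(m,n)$ and $B$ over all $\ell\times \ell$ submatrices of $A$ (any $\ell$ rows and any $\ell$ columns). -}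

module Defs where

open import Algebra.Bundles using (CommutativeRing)
open import Algebra.Definitions.RawMonoid using (_×_)
import Algebra.Construct.NaturalChoice.Max as NaturalMax
import Algebra.Properties.Monoid.Sum as MonoidSum
import Algebra.Properties.Ring as RingProperties
import Algebra.Properties.Semiring.Exp as SemiringExp
open import Data.Bool.Base using (if_then_else_)
open import Data.Fin.Base using (Fin; zero; suc; toℕ; punchIn; remQuot)
open import Data.Fin.Properties using (_≟_)
open import Data.List.Base
  using (List; []; _∷_; _++_; map; concatMap; cartesianProductWith; tabulate; upTo)
import Data.List.Extrema as Extrema
open import Data.Nat.Base as ℕ using (ℕ; zero; suc; NonZero)
open import Data.Product.Base using (∃; _,_; proj₁; proj₂) renaming (_×_ to _and_)
open import Data.Sum.Base using (_⊎_; inj₁; inj₂)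
import Data.Vec.Functional as Vector
open Vector using (Vector)
open import Function.Base using (_∘_)
import Level
open import Relation.Binary.Bundles using (DecTotalOrder)
open import Relation.Binary.Core using (Rel)
import Relation.Binary.Construct.NonStrictToStrict as NonStrictToStrict
import Relation.Binary.Reasoning.PartialOrder as ≤-Reasoning
open import Relation.Binary.Structures using (IsDecTotalOrder)
open import Relation.Nullary.Decidable using (does)
open import Relation.Nullary.Negation using (¬_)
open import Relation.Unary using (Pred; Satisfiable)

module Bounds {a} {A : Set a} (_≤_ : Rel A a) where
  UpperBound LowerBound : Pred A a → Pred A a
  UpperBound P b = ∀ {x} → P x → x ≤ b
  LowerBound P b = ∀ {x} → P x → b ≤ x

-- ℝ is treated axiomatically, as an arbitrary Dedekind-complete ordered field
-- (classically unique up to isomorphism).  The order is decidable and `sup` is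
-- an operation, as they are for the classical reals; such structures exist
-- under excluded middle.  The inverse is total, with 0# ⁻¹ unspecified.

record CompleteOrderedField a : Set (Level.suc a) where
  infix  8 _⁻¹
  infix  4 _≤_
  field
    commutativeRing : CommutativeRing a a

  open CommutativeRing commutativeRing public hiding (zero)

  field
    _⁻¹             : Carrier → Carrier
    0≉1             : ¬ (0# ≈ 1#)
    ⁻¹-inverseʳ     : ∀ {x} → ¬ (x ≈ 0#) → x * x ⁻¹ ≈ 1#
    _≤_             : Rel Carrier a
    isDecTotalOrder : IsDecTotalOrder _≈_ _≤_
    +-monoˡ-≤       : ∀ z {x y} → x ≤ y → x + z ≤ y + z
    *-nonNeg        : ∀ {x y} → 0# ≤ x → 0# ≤ y → 0# ≤ x * y

  open Bounds _≤_ public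

  field
    sup       : (P : Pred Carrier a) → Satisfiable P → Satisfiable (UpperBound P) → Carrier
    sup-upper : ∀ P ne bd → UpperBound P (sup P ne bd)
    sup-least : ∀ P ne bd → LowerBound (UpperBound P) (sup P ne bd)

  decTotalOrder : DecTotalOrder a a a
  decTotalOrder = record { isDecTotalOrder = isDecTotalOrder }

  open DecTotalOrder decTotalOrder public
    using (totalOrder; poset; total; antisym; _≤?_)
    renaming (_≟_ to _≈?_; refl to ≤-refl; reflexive to ≤-reflexive; trans to ≤-trans)

  open NonStrictToStrict _≈_ _≤_ public using (_<_)

module RealOperations {a} (ℝ : CompleteOrderedField a) where
  open CompleteOrderedField ℝ public
  open NaturalMax totalOrder public using (_⊔_)
  open Extrema totalOrder public using (max; ⊥≤max)
  open MonoidSum +-monoid public using (sum; sum-cong-≋; sum-replicate-zero)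
  open SemiringExp semiring public using (_^_)
  open RingProperties ring using (-‿distribˡ-*; -‿distribʳ-*; -‿involutive)

  ∣_∣ : Carrier → Carrier
  ∣ x ∣ = x ⊔ (- x)

  fromℕ : ℕ → Carrier
  fromℕ n = _×_ +-rawMonoid n 1#

  inf : (P : Pred Carrier a) → Satisfiable P → Satisfiable (LowerBound P) → Carrier
  inf P (x , Px) bd = sup (LowerBound P) bd (x , λ b → b Px)

  module _ where
    open ≤-Reasoning poset

    x≤0⇒0≤-x : ∀ {x} → x ≤ 0# → 0# ≤ - x
    x≤0⇒0≤-x {x} x≤0 = begin
      0#        ≈⟨ -‿inverseʳ x ⟨
      x + - x   ≤⟨ +-monoˡ-≤ (- x) x≤0 ⟩
      0# + - x  ≈⟨ +-identityˡ (- x) ⟩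
      - x       ∎

    x≤y⇒0≤y-x : ∀ {x y} → x ≤ y → 0# ≤ y + - x
    x≤y⇒0≤y-x {x} {y} x≤y = begin
      0#       ≈⟨ -‿inverseʳ x ⟨
      x + - x  ≤⟨ +-monoˡ-≤ (- x) x≤y ⟩
      y + - x  ∎

    0≤y-x⇒x≤y : ∀ {x y} → 0# ≤ y + - x → x ≤ y
    0≤y-x⇒x≤y {x} {y} 0≤y-x = begin
      x              ≈⟨ +-identityˡ x ⟨
      0# + x         ≤⟨ +-monoˡ-≤ x 0≤y-x ⟩
      (y + - x) + x  ≈⟨ +-assoc y (- x) x ⟩
      y + (- x + x)  ≈⟨ +-congˡ (-‿inverseˡ x) ⟩
      y + 0#         ≈⟨ +-identityʳ y ⟩
      y              ∎

    0≤x*x : ∀ x → 0# ≤ x * x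
    0≤x*x x with total 0# x
    ... | inj₁ 0≤x = *-nonNeg 0≤x 0≤x
    ... | inj₂ x≤0 = begin
      0#           ≤⟨ *-nonNeg (x≤0⇒0≤-x x≤0) (x≤0⇒0≤-x x≤0) ⟩
      - x * - x    ≈⟨ -‿distribˡ-* x (- x) ⟨
      - (x * - x)  ≈⟨ -‿cong (sym (-‿distribʳ-* x x)) ⟩
      - - (x * x)  ≈⟨ -‿involutive (x * x) ⟩
      x * x        ∎

    0≤1 : 0# ≤ 1#
    0≤1 = ≤-trans (0≤x*x 1#) (≤-reflexive (*-identityˡ 1#))

    *-monoʳ-≤-nonNeg : ∀ {x y z} → 0# ≤ z → x ≤ y → x * z ≤ y * z
    *-monoʳ-≤-nonNeg {x} {y} {z} 0≤z x≤y = 0≤y-x⇒x≤y (begin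
      0#                 ≤⟨ *-nonNeg (x≤y⇒0≤y-x x≤y) 0≤z ⟩
      (y + - x) * z      ≈⟨ distribʳ z y (- x) ⟩
      y * z + - x * z    ≈⟨ +-congˡ (sym (-‿distribˡ-* x z)) ⟩
      y * z + - (x * z)  ∎)

    x≤x*y : ∀ {x y} → 0# ≤ x → 1# ≤ y → x ≤ x * y
    x≤x*y {x} {y} 0≤x 1≤y = begin
      x       ≈⟨ *-identityˡ x ⟨
      1# * x  ≤⟨ *-monoʳ-≤-nonNeg 0≤x 1≤y ⟩
      y * x   ≈⟨ *-comm y x ⟩
      x * y   ∎

    1≤x^n : ∀ {x} n → 1# ≤ x → 1# ≤ x ^ n
    1≤x^n     zero    1≤x = ≤-refl
    1≤x^n {x} (suc n) 1≤x = begin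
      1#         ≤⟨ 1≤x ⟩
      x          ≤⟨ x≤x*y (≤-trans 0≤1 1≤x) (1≤x^n n 1≤x) ⟩
      x * x ^ n  ∎

    x≤x^n : ∀ {x} n .{{_ : NonZero n}} → 1# ≤ x → x ≤ x ^ n
    x≤x^n (suc n) 1≤x = x≤x*y (≤-trans 0≤1 1≤x) (1≤x^n n 1≤x)

    1≤1+x*x : ∀ x → 1# ≤ 1# + x * x
    1≤1+x*x x = begin
      1#          ≈⟨ +-identityˡ 1# ⟨
      0# + 1#     ≤⟨ +-monoˡ-≤ 1# (0≤x*x x) ⟩
      x * x + 1#  ≈⟨ +-comm (x * x) 1# ⟩
      1# + x * x  ∎

    x≤1+x*x : ∀ x → x ≤ 1# + x * x
    x≤1+x*x x with total x 1#
    ... | inj₁ x≤1 = ≤-trans x≤1 (1≤1+x*x x)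
    ... | inj₂ 1≤x = begin
      x           ≤⟨ x≤x*y (≤-trans 0≤1 1≤x) 1≤x ⟩
      x * x       ≈⟨ +-identityˡ (x * x) ⟨
      0# + x * x  ≤⟨ +-monoˡ-≤ (x * x) 0≤1 ⟩
      1# + x * x  ∎

    0≤1+x*x : ∀ x → 0# ≤ 1# + x * x
    0≤1+x*x x = ≤-trans 0≤1 (1≤1+x*x x)

    x^n≤y⇒x≤1+y*y : ∀ {x y} n .{{_ : NonZero n}} → x ^ n ≤ y → x ≤ 1# + y * y
    x^n≤y⇒x≤1+y*y {x} {y} n x^n≤y with total x 1#
    ... | inj₁ x≤1 = ≤-trans x≤1 (1≤1+x*x y)
    ... | inj₂ 1≤x = ≤-trans (x≤x^n n 1≤x) (≤-trans x^n≤y (x≤1+x*x y))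

  -- The alternative y ≈ 0# only matters for x < 0, where the root is then 0.

  RootSet : ℕ → Carrier → Pred Carrier a
  RootSet n x y = y ≈ 0# ⊎ (0# ≤ y and y ^ n ≤ x)

  rootSet-bounded : ∀ n .{{_ : NonZero n}} x → UpperBound (RootSet n x) (1# + x * x)
  rootSet-bounded n x (inj₁ y≈0)         = ≤-trans (≤-reflexive y≈0) (0≤1+x*x x)
  rootSet-bounded n x (inj₂ (_ , y^n≤x)) = x^n≤y⇒x≤1+y*y n y^n≤x

  root : ∀ n .{{_ : NonZero n}} → Carrier → Carrier
  root n x = sup (RootSet n x) (0# , inj₁ refl) (_ , rootSet-bounded n x)

  √_ : Carrier → Carrier
  √ x = root 2 x

  -- The natural logarithm.  For x ≥ 0 the sequence (1 + x/m)^m increases to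
  -- exp x, so the second alternative says exp x ≤ y, and log y is the supremum
  -- of {x ≥ 0 | exp x ≤ y} for y ≥ 1.  For y < 1 the value is 0.

  LogSet : Carrier → Pred Carrier a
  LogSet y x = x ≈ 0# ⊎ (0# ≤ x and (∀ m → (1# + x * fromℕ (suc m) ⁻¹) ^ suc m ≤ y))

  logSet-bounded : ∀ y → UpperBound (LogSet y) (1# + y * y)
  logSet-bounded y     (inj₁ x≈0)       = ≤-trans (≤-reflexive x≈0) (0≤1+x*x y)
  logSet-bounded y {x} (inj₂ (_ , exp≤)) = begin
      x                                 ≈⟨ +-identityˡ x ⟨
      0# + x                            ≤⟨ +-monoˡ-≤ x 0≤1 ⟩
      1# + x                            ≈⟨ +-congˡ (*-identityʳ x) ⟨
      1# + x * 1#                       ≈⟨ +-congˡ (*-congˡ one⁻¹) ⟨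
      1# + x * fromℕ 1 ⁻¹               ≈⟨ *-identityʳ _ ⟨
      (1# + x * fromℕ 1 ⁻¹) ^ 1         ≤⟨ exp≤ 0 ⟩
      y                                 ≤⟨ x≤1+x*x y ⟩
      1# + y * y                        ∎
    where
    open ≤-Reasoning poset
    one≉0 : ¬ (fromℕ 1 ≈ 0#)
    one≉0 eq = 0≉1 (trans (sym eq) (+-identityʳ 1#))
    one⁻¹ : fromℕ 1 ⁻¹ ≈ 1#
    one⁻¹ = trans (sym (*-identityˡ _))
      (trans (*-congʳ (sym (+-identityʳ 1#))) (⁻¹-inverseʳ one≉0))

  log : Carrier → Carrier
  log y = sup (LogSet y) (0# , inj₁ refl) (_ , logSet-bounded y)

  √1≈1 : ∀ {x} → x ≈ 1# → √ x ≈ 1#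
  √1≈1 {x} x≈1 = antisym (sup-least _ _ _ upper) (sup-upper _ _ _ (inj₂ (0≤1 , lower)))
    where
    open ≤-Reasoning poset
    upper : UpperBound (RootSet 2 x) 1#
    upper     (inj₁ y≈0) = ≤-trans (≤-reflexive y≈0) 0≤1
    upper {y} (inj₂ (_ , y²≤x)) with total y 1#
    ... | inj₁ y≤1 = y≤1
    ... | inj₂ 1≤y = ≤-trans (x≤x^n 2 1≤y) (≤-trans y²≤x (≤-reflexive x≈1))
    lower : 1# ^ 2 ≤ x
    lower = begin
      1# * (1# * 1#)  ≈⟨ *-identityˡ _ ⟩
      1# * 1#         ≈⟨ *-identityˡ _ ⟩
      1#              ≈⟨ x≈1 ⟨
      x               ∎

-- All strictly increasing maps Fin ℓ → Fin m, i.e. all ℓ-element subsets of Fin m.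

selections : ∀ m ℓ → List (Vector (Fin m) ℓ)
selections m       zero    = Vector.[] ∷ []
selections zero    (suc ℓ) = []
selections (suc m) (suc ℓ) =
  map (λ f → zero Vector.∷ (suc ∘ f)) (selections m ℓ) ++
  map (suc ∘_) (selections m (suc ℓ))

module Discrepancy {a} (ℝ : CompleteOrderedField a) where
  open RealOperations ℝ public

  Matrix : ℕ → ℕ → Set a
  Matrix m n = Fin m → Fin n → Carrier

  submatrix : ∀ {m n k ℓ} → Matrix m n → Vector (Fin m) k → Vector (Fin n) ℓ → Matrix k ℓ
  submatrix A r c i j = A (r i) (c j)

  columns : ∀ {m n ℓ} → Matrix m n → Vector (Fin n) ℓ → Matrix m ℓ
  columns A c = submatrix A (λ i → i) c

  identity : ∀ {n} → Matrix n n
  identity i j = if does (i ≟ j) then 1# else 0#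

  det : ∀ {n} → Matrix n n → Carrier
  det {zero}  A = 1#
  det {suc n} A =
    sum (λ j → (- 1#) ^ toℕ j * (A zero j * det (λ i ℓ → A (suc i) (punchIn j ℓ))))

  ‖_‖ : ∀ {n} → Vector Carrier n → Carrier
  ‖ v ‖ = √ (sum (λ t → v t * v t))

  combination : ∀ {n d} → Vector Carrier n → (Fin n → Vector Carrier d) → Vector Carrier d
  combination x v t = sum (λ i → x i * v i t)

  -- All maxima below are of nonnegative quantities, so including the default
  -- 0# changes nothing unless the range is empty.

  vectorDiscrepancy : ∀ {m n d} → Matrix m n → (Fin n → Vector Carrier d) → Carrier
  vectorDiscrepancy A v = max 0# (tabulate (λ j → ‖ combination (A j) v ‖))

  VecdiscSet : ∀ {m n} → Matrix m n → Pred Carrier a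
  VecdiscSet {n = n} A r =
    ∃ λ (v : Fin n → Vector Carrier n) → (∀ i → ‖ v i ‖ ≈ 1#) and r ≈ vectorDiscrepancy A v

  ‖eᵢ‖≈1 : ∀ {n} (i : Fin n) → ‖ identity i ‖ ≈ 1#
  ‖eᵢ‖≈1 i = √1≈1 (sum-eᵢ i)
    where
    sum-eᵢ : ∀ {n} (i : Fin n) → sum (λ t → identity i t * identity i t) ≈ 1#
    sum-eᵢ {suc n} zero = trans
      (+-cong (*-identityˡ 1#)
        (trans (sum-cong-≋ {n} (λ _ → zeroˡ 0#)) (sum-replicate-zero n)))
      (+-identityʳ 1#)
    sum-eᵢ (suc i) = trans (+-cong (zeroˡ 0#) (sum-eᵢ i)) (+-identityˡ 1#)

  vecdiscSet-satisfiable : ∀ {m n} (A : Matrix m n) → Satisfiable (VecdiscSet A)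
  vecdiscSet-satisfiable A = _ , identity , ‖eᵢ‖≈1 , refl

  vecdiscSet-bounded : ∀ {m n} (A : Matrix m n) → LowerBound (VecdiscSet A) 0#
  vecdiscSet-bounded A (v , _ , r≈) =
    ≤-trans (⊥≤max 0# (tabulate (λ j → ‖ combination (A j) v ‖))) (≤-reflexive (sym r≈))

  -- The infimum is attained, as the product of spheres is compact.

  vecdisc : ∀ {m n} → Matrix m n → Carrier
  vecdisc A = inf (VecdiscSet A) (vecdiscSet-satisfiable A) (_ , vecdiscSet-bounded A)

  hervecdisc : ∀ {m n} → Matrix m n → Carrier
  hervecdisc {n = n} A = max 0#
    (concatMap (λ ℓ → map (λ c → vecdisc (columns A c)) (selections n (suc ℓ))) (upTo n))

  detlb : ∀ {m n} → Matrix m n → Carrier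
  detlb {m} {n} A = max 0#
    (concatMap
      (λ ℓ → cartesianProductWith (λ r c → root (suc ℓ) ∣ det (submatrix A r c) ∣)
               (selections m (suc ℓ)) (selections n (suc ℓ)))
      (upTo (m ℕ.⊓ n)))

  block : ∀ {n} → Matrix n n → Matrix n n → Matrix n n → Matrix n n → Matrix (2 ℕ.* n) (2 ℕ.* n)
  block {n} A B C D i j with remQuot {2} n i | remQuot {2} n j
  ... | zero     , i′ | zero     , j′ = A i′ j′
  ... | zero     , i′ | suc zero , j′ = B i′ j′
  ... | suc zero , i′ | zero     , j′ = C i′ j′
  ... | suc zero , i′ | suc zero , j′ = D i′ j′

  haar : ∀ k → Matrix (2 ℕ.^ k) (2 ℕ.^ k)
  haar zero    i j = 1#
  haar (suc k) = block (haar k) identity (haar k) (λ i j → - identity i j)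

-- Expanding a minor of A_k along a column from the right half (which has at most two nonzero entries
-- there, ±1) shows that an ℓ × ℓ minor is at most 2 ^ ℓ in absolute value, whence detlb A_k ≤ 2.
-- Choosing between the rows s + v and s − v level by level, so that ∥s ± v∥² ≥ ∥s∥² + ∥v∥², yields for any
-- unit vectors a row of A_k whose combination has squared norm at least k + 1, so already
-- vecdisc A_k ≥ √ (k + 1).  Since log (2 ^ k) ≤ k, the constant 1/2 works.

module Submission where

open import Defs
open import Data.Nat.Base as ℕ using (ℕ)
open import Data.Product.Base using (∃; _×_)

import Algebra.Construct.NaturalChoice.Max as NaturalMax
import Algebra.Properties.Ring as RingProperties
import Algebra.Properties.Semiring.Exp as SemiringExp
import Algebra.Properties.Semiring.Mult as SemiringMult
import Algebra.Properties.Semiring.Sum as SemiringSum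
import Algebra.Solver.Ring.NaturalCoefficients.Default as RingSolver
open import Data.Bool.Base using (true; false; if_then_else_)
open import Data.Fin.Base
  using (Fin; zero; suc; toℕ; punchIn; punchOut; combine; remQuot; quotient; remainder; _↑ˡ_; _↑ʳ_)
open import Data.Fin.Properties
  using (_≟_; any?; suc-injective; punchIn-injective; punchIn-punchOut; remQuot-combine; combine-remQuot)
import Data.List.Base as List
import Data.List.Extrema as Extrema
open import Data.List.Relation.Unary.All as All using (All; []; _∷_)
import Data.List.Relation.Unary.All.Properties as All
open import Data.List.Relation.Unary.Any as Any using (Any; here)
import Data.List.Relation.Unary.Any.Properties as Any
open import Data.Nat.Base using (zero; suc; NonZero)
import Data.Nat.Properties as ℕ
open import Data.Product.Base using (_,_; proj₁; proj₂)
open import Data.Sum.Base using (_⊎_; inj₁; inj₂; [_,_]′)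
open import Data.Vec.Functional using (Vector) renaming (_∷_ to _∷ᵛ_)
open import Function.Base using (_∘_; flip)
open import Function.Definitions using (Injective)
open import Relation.Binary.PropositionalEquality as ≡ using (_≡_; _≢_)
import Relation.Binary.Reasoning.PartialOrder as ≤-Reasoning
import Relation.Binary.Reasoning.Setoid as ≈-Reasoning
open import Relation.Nullary.Decidable using (yes; no; ¬?; _×-dec_; does)
open import Relation.Nullary.Negation using (¬_; contradiction)

-- The column expansion needs a column from the right half. A minor without one has its rows among
-- those of A_(k-1), each taken at most twice: it vanishes if a row repeats and otherwise is a minor
-- of A_(k-1) of the same size. The induction thus lowers either ℓ or k. Passing to A_(k-1) keeps
-- the chosen indices distinct but not increasing, so minors are indexed by injective maps. `det` is
-- defined along the first row, so an expansion along an arbitrary column has to be derived. `root`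
-- and `log` are suprema; they are only compared with bounds, never evaluated.

-- Arithmetic of ordered fields.

module OrderedFieldProperties {a} (ℝ : CompleteOrderedField a) where
  open RealOperations ℝ
  open NaturalMax totalOrder using (⊔-lub; ⊔-cong; ⊔-comm; x≤x⊔y; x≤y⊔x)
  open RingProperties ring public using (-1*x≈-x)
  open RingProperties ring using (-‿involutive; -‿+-comm)
  open SemiringExp semiring using (^-congˡ)
  open SemiringMult semiring using (×1-homo-*)
  open SemiringSum semiring using (∑-distrib-+)
  open RingSolver commutativeSemiring using (solve; _:=_; _:+_; _:*_; con)
  open ≤-Reasoning poset

  +-mono-≤ : ∀ {x y u v} → x ≤ y → u ≤ v → x + u ≤ y + v
  +-mono-≤ {x} {y} {u} {v} x≤y u≤v = begin
    x + u  ≤⟨ +-monoˡ-≤ u x≤y ⟩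
    y + u  ≈⟨ +-comm y u ⟩
    u + y  ≤⟨ +-monoˡ-≤ y u≤v ⟩
    v + y  ≈⟨ +-comm v y ⟩
    y + v  ∎

  x≤x+y : ∀ {x y} → 0# ≤ y → x ≤ x + y
  x≤x+y {x} {y} 0≤y = begin
    x       ≈⟨ +-identityʳ x ⟨
    x + 0#  ≤⟨ +-mono-≤ ≤-refl 0≤y ⟩
    x + y   ∎

  +-cancelʳ-≤ : ∀ z {x y} → x + z ≤ y + z → x ≤ y
  +-cancelʳ-≤ z {x} {y} x+z≤y+z = begin
    x            ≈⟨ cancel x ⟨
    x + z + - z  ≤⟨ +-monoˡ-≤ (- z) x+z≤y+z ⟩
    y + z + - z  ≈⟨ cancel y ⟩
    y            ∎
    where
    cancel : ∀ w → w + z + - z ≈ w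
    cancel w = trans (+-assoc w z (- z)) (trans (+-congˡ (-‿inverseʳ z)) (+-identityʳ w))

  0≤x⇒-x≤0 : ∀ {x} → 0# ≤ x → - x ≤ 0#
  0≤x⇒-x≤0 {x} 0≤x = begin
    - x       ≈⟨ +-identityˡ (- x) ⟨
    0# + - x  ≤⟨ +-monoˡ-≤ (- x) 0≤x ⟩
    x + - x   ≈⟨ -‿inverseʳ x ⟩
    0#        ∎

  x≈-x⇒x≈0 : ∀ {x} → x ≈ - x → x ≈ 0#
  x≈-x⇒x≈0 {x} x≈-x with total 0# x
  ... | inj₁ 0≤x = antisym (≤-trans (≤-reflexive x≈-x) (0≤x⇒-x≤0 0≤x)) 0≤x
  ... | inj₂ x≤0 = antisym x≤0 (≤-trans (x≤0⇒0≤-x x≤0) (≤-reflexive (sym x≈-x)))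

  two : Carrier
  two = fromℕ 2

  x+x≈two*x : ∀ x → x + x ≈ two * x
  x+x≈two*x = solve 1 (λ x → x :+ x := (con 1 :+ (con 1 :+ con 0)) :* x) refl

  0≤fromℕ : ∀ n → 0# ≤ fromℕ n
  0≤fromℕ zero    = ≤-refl
  0≤fromℕ (suc n) = ≤-trans 0≤1 (x≤x+y (0≤fromℕ n))

  1≤fromℕ-suc : ∀ n → 1# ≤ fromℕ (suc n)
  1≤fromℕ-suc n = x≤x+y (0≤fromℕ n)

  fromℕ-suc≉0 : ∀ n → ¬ fromℕ (suc n) ≈ 0#
  fromℕ-suc≉0 n eq = 0≉1 (antisym 0≤1 (≤-trans (1≤fromℕ-suc n) (≤-reflexive eq)))

  1≤two : 1# ≤ two
  1≤two = 1≤fromℕ-suc 1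

  fromℕ-2^ : ∀ k → fromℕ (2 ℕ.^ k) ≈ two ^ k
  fromℕ-2^ zero    = +-identityʳ 1#
  fromℕ-2^ (suc k) = trans (×1-homo-* 2 (2 ℕ.^ k)) (*-congˡ (fromℕ-2^ k))

  half : Carrier
  half = two ⁻¹

  two*half≈1 : two * half ≈ 1#
  two*half≈1 = ⁻¹-inverseʳ (fromℕ-suc≉0 1)

  -- The axioms give no sign for `_⁻¹`, but `half` equals `two * (half * half)`, a nonnegative
  -- number times a square.
  0≤half : 0# ≤ half
  0≤half = begin
    0#                   ≤⟨ *-nonNeg (0≤fromℕ 2) (0≤x*x half) ⟩
    two * (half * half)  ≈⟨ *-assoc two half half ⟨
    (two * half) * half  ≈⟨ *-congʳ two*half≈1 ⟩
    1# * half            ≈⟨ *-identityˡ half ⟩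
    half                 ∎

  0<half : 0# < half
  0<half = 0≤half , λ 0≈half →
    0≉1 (trans (sym (zeroʳ two)) (trans (*-congˡ 0≈half) two*half≈1))

  ^-monoˡ-≤ : ∀ {x y} n → 0# ≤ x → x ≤ y → x ^ n ≤ y ^ n
  ^-monoˡ-≤         zero    0≤x x≤y = ≤-refl
  ^-monoˡ-≤ {x} {y} (suc n) 0≤x x≤y = begin
    x * x ^ n  ≤⟨ *-monoʳ-≤-nonNeg (0≤x^ n) x≤y ⟩
    y * x ^ n  ≈⟨ *-comm y _ ⟩
    x ^ n * y  ≤⟨ *-monoʳ-≤-nonNeg (≤-trans 0≤x x≤y) (^-monoˡ-≤ n 0≤x x≤y) ⟩
    y ^ n * y  ≈⟨ *-comm _ y ⟩
    y * y ^ n  ∎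
    where
    0≤x^ : ∀ m → 0# ≤ x ^ m
    0≤x^ zero    = 0≤1
    0≤x^ (suc m) = *-nonNeg 0≤x (0≤x^ m)

  -- If `b ≤ x`, then x - b ≤ (x - b) b^n ≤ x^(n+1) - b^(n+1) ≤ 0, where `1# ≤ b` gives the first
  -- inequality. Both the bound on roots and the bound on the logarithm come down to this with `b`
  -- equal to `two`.
  ^-cancelʳ-≤ : ∀ {x b} n → 1# ≤ b → x ^ suc n ≤ b ^ suc n → x ≤ b
  ^-cancelʳ-≤ {x} {b} n 1≤b x^≤b^ with total x b
  ... | inj₁ x≤b = x≤b
  ... | inj₂ b≤x = +-cancelʳ-≤ (- b) (begin
    x + - b                  ≤⟨ x≤x*y (x≤y⇒0≤y-x b≤x) (1≤x^n n 1≤b) ⟩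
    (x + - b) * b ^ n        ≈⟨ distribʳ (b ^ n) x (- b) ⟩
    x * b ^ n + - b * b ^ n  ≤⟨ +-monoˡ-≤ _ x*b^n≤b*b^n ⟩
    b * b ^ n + - b * b ^ n  ≈⟨ distribʳ (b ^ n) b (- b) ⟨
    (b + - b) * b ^ n        ≈⟨ *-congʳ (-‿inverseʳ b) ⟩
    0# * b ^ n               ≈⟨ zeroˡ _ ⟩
    0#                       ≈⟨ -‿inverseʳ b ⟨
    b + - b                  ∎)
    where
    0≤b : 0# ≤ b
    0≤b = ≤-trans 0≤1 1≤b

    x*b^n≤b*b^n : x * b ^ n ≤ b * b ^ n
    x*b^n≤b*b^n = begin
      x * b ^ n  ≈⟨ *-comm x _ ⟩
      b ^ n * x  ≤⟨ *-monoʳ-≤-nonNeg (≤-trans 0≤b b≤x) (^-monoˡ-≤ n 0≤b b≤x) ⟩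
      x ^ n * x  ≈⟨ *-comm _ x ⟩
      x * x ^ n  ≤⟨ x^≤b^ ⟩
      b * b ^ n  ∎

  ∣∣-cong : ∀ {x y} → x ≈ y → ∣ x ∣ ≈ ∣ y ∣
  ∣∣-cong x≈y = ⊔-cong x≈y (-‿cong x≈y)

  ∣-x∣≈∣x∣ : ∀ x → ∣ - x ∣ ≈ ∣ x ∣
  ∣-x∣≈∣x∣ x = trans (⊔-cong refl (-‿involutive x)) (⊔-comm (- x) x)

  ∣x+y∣≤∣x∣+∣y∣ : ∀ x y → ∣ x + y ∣ ≤ ∣ x ∣ + ∣ y ∣
  ∣x+y∣≤∣x∣+∣y∣ x y = ⊔-lub
    (+-mono-≤ (x≤x⊔y x (- x)) (x≤x⊔y y (- y)))
    (≤-trans (≤-reflexive (sym (-‿+-comm x y))) (+-mono-≤ (x≤y⊔x x (- x)) (x≤y⊔x y (- y))))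

  0≤x⇒∣x∣≤x : ∀ {x} → 0# ≤ x → ∣ x ∣ ≤ x
  0≤x⇒∣x∣≤x 0≤x = ⊔-lub ≤-refl (≤-trans (0≤x⇒-x≤0 0≤x) 0≤x)

  x≈0⇒∣x∣≤0 : ∀ {x} → x ≈ 0# → ∣ x ∣ ≤ 0#
  x≈0⇒∣x∣≤0 x≈0 = ≤-trans (≤-reflexive (∣∣-cong x≈0)) (0≤x⇒∣x∣≤x ≤-refl)

  -- Signs, and sums with few nonzero terms.

  sign : ∀ {n} → Fin n → Carrier
  sign p = (- 1#) ^ toℕ p

  -1*-1≈1 : - 1# * - 1# ≈ 1#
  -1*-1≈1 = trans (-1*x≈-x (- 1#)) (-‿involutive 1#)

  sign*sign≈1 : ∀ {n} (p : Fin n) → sign p * sign p ≈ 1#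
  sign*sign≈1 zero    = *-identityˡ 1#
  sign*sign≈1 (suc p) = begin-equality
    (- 1# * sign p) * (- 1# * sign p)
      ≈⟨ solve 2 (λ m s → (m :* s) :* (m :* s) := (m :* m) :* (s :* s)) refl (- 1#) (sign p) ⟩
    (- 1# * - 1#) * (sign p * sign p)
      ≈⟨ *-cong -1*-1≈1 (sign*sign≈1 p) ⟩
    1# * 1#
      ≈⟨ *-identityˡ 1# ⟩
    1#
      ∎

  sign₁*x≈-x : ∀ x → sign {2} (suc zero) * x ≈ - x
  sign₁*x≈-x x = trans (*-congʳ (*-identityʳ (- 1#))) (-1*x≈-x x)

  sign-cancel : ∀ {n} (p : Fin n) x → sign p * (sign p * x) ≈ x
  sign-cancel p x = trans (sym (*-assoc _ _ x)) (trans (*-congʳ (sign*sign≈1 p)) (*-identityˡ x))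

  sign*x≈0⇒x≈0 : ∀ {n} (p : Fin n) {x} → sign p * x ≈ 0# → x ≈ 0#
  sign*x≈0⇒x≈0 p {x} eq = trans (sym (sign-cancel p x)) (trans (*-congˡ eq) (zeroʳ _))

  ∣sign*x∣≈∣x∣ : ∀ {n} (p : Fin n) x → ∣ sign p * x ∣ ≈ ∣ x ∣
  ∣sign*x∣≈∣x∣ zero    x = ∣∣-cong (*-identityˡ x)
  ∣sign*x∣≈∣x∣ (suc p) x = begin-equality
    ∣ (- 1# * sign p) * x ∣  ≈⟨ ∣∣-cong (trans (*-assoc _ _ x) (-1*x≈-x _)) ⟩
    ∣ - (sign p * x) ∣       ≈⟨ ∣-x∣≈∣x∣ _ ⟩
    ∣ sign p * x ∣           ≈⟨ ∣sign*x∣≈∣x∣ p x ⟩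
    ∣ x ∣                    ∎

  sum-zero : ∀ {n} {f : Vector Carrier n} → (∀ i → f i ≈ 0#) → sum f ≈ 0#
  sum-zero {n} f≈0 = trans (sum-cong-≋ f≈0) (sum-replicate-zero n)

  ∣sum∣-atMostOne : ∀ {n b} (f : Vector Carrier n) → 0# ≤ b → (∀ i → ∣ f i ∣ ≤ b) →
                    (∀ {i j} → i ≢ j → f i ≈ 0# ⊎ f j ≈ 0#) → ∣ sum f ∣ ≤ b
  ∣sum∣-atMostOne {zero}      f 0≤b f≤b one = ≤-trans (0≤x⇒∣x∣≤x ≤-refl) 0≤b
  ∣sum∣-atMostOne {suc n} {b} f 0≤b f≤b one with f zero ≈? 0#
  ... | yes f₀≈0 = begin
    ∣ f zero + sum (f ∘ suc) ∣  ≈⟨ ∣∣-cong (trans (+-congʳ f₀≈0) (+-identityˡ _)) ⟩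
    ∣ sum (f ∘ suc) ∣           ≤⟨ ∣sum∣-atMostOne (f ∘ suc) 0≤b (f≤b ∘ suc) (λ i≢j → one (i≢j ∘ λ { ≡.refl → ≡.refl })) ⟩
    b                           ∎
  ... | no f₀≉0 = begin
    ∣ f zero + sum (f ∘ suc) ∣  ≈⟨ ∣∣-cong (trans (+-congˡ (sum-zero tail≈0)) (+-identityʳ _)) ⟩
    ∣ f zero ∣                  ≤⟨ f≤b zero ⟩
    b                           ∎
    where
    tail≈0 : ∀ i → f (suc i) ≈ 0#
    tail≈0 i = [ (λ f₀≈0 → contradiction f₀≈0 f₀≉0) , (λ eq → eq) ]′ (one {zero} {suc i} λ ())

  -- Made for the expansion of a minor along a right-half column: the label of a row is the half of
  -- the matrix, upper or lower, in which it lies. Splitting the sum by label leaves two sums with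
  -- at most one nonzero term each.
  ∣sum∣-atMostTwo : ∀ {n b} (f : Vector Carrier n) (label : Fin n → Fin 2) →
                    0# ≤ b → (∀ i → ∣ f i ∣ ≤ b) →
                    (∀ {i j} → i ≢ j → label i ≡ label j → f i ≈ 0# ⊎ f j ≈ 0#) →
                    ∣ sum f ∣ ≤ b + b
  ∣sum∣-atMostTwo {n} {b} f label 0≤b f≤b one = begin
    ∣ sum f ∣                                       ≈⟨ ∣∣-cong (trans (sum-cong-≋ split) (∑-distrib-+ (part zero) (part (suc zero)))) ⟩
    ∣ sum (part zero) + sum (part (suc zero)) ∣     ≤⟨ ∣x+y∣≤∣x∣+∣y∣ _ _ ⟩
    ∣ sum (part zero) ∣ + ∣ sum (part (suc zero)) ∣ ≤⟨ +-mono-≤ (bound zero) (bound (suc zero)) ⟩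
    b + b                                           ∎
    where
    part : Fin 2 → Vector Carrier n
    part c i = if does (label i ≟ c) then f i else 0#

    split : ∀ i → f i ≈ part zero i + part (suc zero) i
    split i with label i
    ... | zero     = sym (+-identityʳ _)
    ... | suc zero = sym (+-identityˡ _)

    part≤b : ∀ c i → ∣ part c i ∣ ≤ b
    part≤b c i with does (label i ≟ c)
    ... | true  = f≤b i
    ... | false = ≤-trans (0≤x⇒∣x∣≤x ≤-refl) 0≤b

    part-one : ∀ c {i j} → i ≢ j → part c i ≈ 0# ⊎ part c j ≈ 0#
    part-one c {i} {j} i≢j with label i ≟ c | label j ≟ c
    ... | no _   | _      = inj₁ refl
    ... | yes _  | no _   = inj₂ refl
    ... | yes eq | yes eq′ = one i≢j (≡.trans eq (≡.sym eq′))

    bound : ∀ c → ∣ sum (part c) ∣ ≤ b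
    bound c = ∣sum∣-atMostOne (part c) 0≤b (part≤b c) (part-one c)

  -- Bounds on roots and logarithms.

  root≤ : ∀ n {x b} → 1# ≤ b → x ≤ b ^ suc n → root (suc n) x ≤ b
  root≤ n {x} {b} 1≤b x≤b^ = sup-least _ _ _ upper
    where
    upper : UpperBound (RootSet (suc n) x) b
    upper (inj₁ y≈0)        = ≤-trans (≤-reflexive y≈0) (≤-trans 0≤1 1≤b)
    upper (inj₂ (_ , y^≤x)) = ^-cancelʳ-≤ n 1≤b (≤-trans y^≤x x≤b^)

  √-mono-≤ : ∀ {x y} → x ≤ y → √ x ≤ √ y
  √-mono-≤ {x} {y} x≤y = sup-least _ _ _ λ
    { (inj₁ z≈0)         → sup-upper _ _ _ (inj₁ z≈0)
    ; (inj₂ (0≤z , z²≤x)) → sup-upper _ _ _ (inj₂ (0≤z , ≤-trans z²≤x x≤y))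
    }

  0≤√ : ∀ x → 0# ≤ √ x
  0≤√ x = sup-upper _ _ _ (inj₁ refl)

  -- y ² ≤ x gives y ≤ (1 + x) / 2, hence √ x ≤ (1 + x) / 2 without knowing (√ x)² ≈ x.
  √x≈1⇒1≤x : ∀ {x} → 0# ≤ x → √ x ≈ 1# → 1# ≤ x
  √x≈1⇒1≤x {x} 0≤x √x≈1 = +-cancelʳ-≤ 1# (begin
    1# + 1#                ≈⟨ x+x≈two*x 1# ⟩
    two * 1#               ≈⟨ *-comm two 1# ⟩
    1# * two               ≤⟨ *-monoʳ-≤-nonNeg (0≤fromℕ 2) (≤-trans (≤-reflexive (sym √x≈1)) (sup-least _ _ _ upper)) ⟩
    (x + 1#) * half * two  ≈⟨ *-assoc _ _ _ ⟩
    (x + 1#) * (half * two) ≈⟨ *-congˡ (trans (*-comm half two) two*half≈1) ⟩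
    (x + 1#) * 1#          ≈⟨ *-identityʳ _ ⟩
    x + 1#                 ∎)
    where
    upper : UpperBound (RootSet 2 x) ((x + 1#) * half)
    upper (inj₁ y≈0) = ≤-trans (≤-reflexive y≈0)
      (*-nonNeg (≤-trans 0≤1 (≤-trans (x≤x+y 0≤x) (≤-reflexive (+-comm 1# x)))) 0≤half)
    upper {y} (inj₂ (_ , y²≤x)) = begin
      y                   ≈⟨ *-identityʳ y ⟨
      y * 1#              ≈⟨ *-congˡ two*half≈1 ⟨
      y * (two * half)    ≈⟨ *-assoc y two half ⟨
      (y * two) * half    ≤⟨ *-monoʳ-≤-nonNeg 0≤half y*two≤ ⟩
      (x + 1#) * half     ∎
      where
      z : Carrier
      z = y + - 1#

      y≈z+1 : y ≈ z + 1#
      y≈z+1 = sym (trans (+-assoc y (- 1#) 1#) (trans (+-congˡ (-‿inverseˡ 1#)) (+-identityʳ y)))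

      y*two≤ : y * two ≤ x + 1#
      y*two≤ = begin
        y * two                         ≈⟨ *-congʳ y≈z+1 ⟩
        (z + 1#) * two                  ≤⟨ x≤x+y (0≤x*x z) ⟩
        (z + 1#) * two + z * z          ≈⟨ solve 1 (λ z → (z :+ con 1) :* (con 1 :+ (con 1 :+ con 0)) :+ z :* z
                                             := (z :+ con 1) :* ((z :+ con 1) :* con 1) :+ con 1) refl z ⟩
        (z + 1#) ^ 2 + 1#               ≈⟨ +-congʳ (^-congˡ 2 y≈z+1) ⟨
        y ^ 2 + 1#                      ≤⟨ +-monoˡ-≤ 1# y²≤x ⟩
        x + 1#                          ∎

  -- (1 + x / k) ^ k ≤ 2 ^ k forces x ≤ k.
  log2^k≤k : ∀ k .{{_ : NonZero k}} → log (fromℕ (2 ℕ.^ k)) ≤ fromℕ k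
  log2^k≤k (suc m) = sup-least _ _ _ upper
    where
    k : Carrier
    k = fromℕ (suc m)

    upper : UpperBound (LogSet (fromℕ (2 ℕ.^ suc m))) k
    upper     (inj₁ x≈0)        = ≤-trans (≤-reflexive x≈0) (0≤fromℕ (suc m))
    upper {x} (inj₂ (_ , exp≤)) = begin
      x               ≈⟨ *-identityʳ x ⟨
      x * 1#          ≈⟨ *-congˡ (trans (*-comm _ _) (⁻¹-inverseʳ (fromℕ-suc≉0 m))) ⟨
      x * (k ⁻¹ * k)  ≈⟨ *-assoc x _ _ ⟨
      x * k ⁻¹ * k    ≤⟨ *-monoʳ-≤-nonNeg (0≤fromℕ (suc m)) x/k≤1 ⟩
      1# * k          ≈⟨ *-identityˡ k ⟩
      k               ∎
      where
      x/k≤1 : x * k ⁻¹ ≤ 1#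
      x/k≤1 = +-cancelʳ-≤ 1# (begin
        x * k ⁻¹ + 1#     ≈⟨ +-comm _ 1# ⟩
        1# + x * k ⁻¹     ≤⟨ ^-cancelʳ-≤ m 1≤two (≤-trans (exp≤ m) (≤-reflexive (fromℕ-2^ (suc m)))) ⟩
        1# + (1# + 0#)    ≈⟨ +-congˡ (+-identityʳ 1#) ⟩
        1# + 1#           ∎)

-- Determinants: column expansion and the alternating property.

module DeterminantProperties {a} (ℝ : CompleteOrderedField a) where
  open Discrepancy ℝ
  open OrderedFieldProperties ℝ
  open SemiringSum semiring using (∑-comm; *-distribˡ-sum)
  open RingSolver commutativeSemiring using (solve; _:=_; _:+_; _:*_; con)
  open ≈-Reasoning setoid

  *-congʳ² : ∀ x y {u v} → u ≈ v → x * (y * u) ≈ x * (y * v)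
  *-congʳ² x y u≈v = *-congˡ (*-congˡ u≈v)

  *-distribˡ²-sum : ∀ {n} x y (f : Vector Carrier n) → x * (y * sum f) ≈ sum (λ i → x * (y * f i))
  *-distribˡ²-sum {n} x y f = trans (*-congˡ (*-distribˡ-sum y f)) (*-distribˡ-sum x (λ i → y * f i))

  minor : ∀ {n} → Matrix (suc n) (suc n) → Fin (suc n) → Fin (suc n) → Matrix n n
  minor A p q i j = A (punchIn p i) (punchIn q j)

  transpose : ∀ {m n} → Matrix m n → Matrix n m
  transpose = flip

  det-cong : ∀ {n} {A B : Matrix n n} → (∀ i j → A i j ≈ B i j) → det A ≈ det B
  det-cong {zero}  A≈B = refl
  det-cong {suc n} A≈B = sum-cong-≋ λ j →
    *-congˡ {x = sign j} (*-cong (A≈B zero j) (det-cong λ i ℓ → A≈B (suc i) (punchIn j ℓ)))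

  det-congRows : ∀ {m n} (A : Matrix m n) {f g : Fin n → Fin m} → (∀ i → f i ≡ g i) → det (A ∘ f) ≈ det (A ∘ g)
  det-congRows A f≗g = det-cong λ i j → reflexive (≡.cong (λ r → A r j) (f≗g i))

  -- The corner term is common to the row and the column expansion. Expanding the minors of the
  -- other terms along their first column, by induction, gives a double sum over rows `q` and
  -- columns `j`; exchanging the sums, the inner one is again a row expansion.
  det-expandColumn₀ : ∀ {n} (A : Matrix (suc n) (suc n)) →
                      det A ≈ sum (λ q → sign q * (A q zero * det (minor A q zero)))
  det-expandColumn₀ {zero}  A = refl
  det-expandColumn₀ {suc n} A = +-congˡ (begin
    sum (λ j → sign (suc j) * (A zero (suc j) * det (minor A zero (suc j))))
      ≈⟨ sum-cong-≋ (λ j → trans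
           (*-congʳ² (sign (suc j)) (A zero (suc j)) (det-expandColumn₀ (minor A zero (suc j))))
           (*-distribˡ²-sum (sign (suc j)) (A zero (suc j)) (λ q → sign q * (A (suc q) zero * D q j)))) ⟩
    sum (λ j → sum (λ q → sign (suc j) * (A zero (suc j) * (sign q * (A (suc q) zero * D q j)))))
      ≈⟨ ∑-comm (λ j q → sign (suc j) * (A zero (suc j) * (sign q * (A (suc q) zero * D q j)))) ⟩
    sum (λ q → sum (λ j → sign (suc j) * (A zero (suc j) * (sign q * (A (suc q) zero * D q j)))))
      ≈⟨ sum-cong-≋ (λ q → sum-cong-≋ (λ j → solve 6
           (λ m s t x y d → (m :* s) :* (x :* (t :* (y :* d))) := (m :* t) :* (y :* (s :* (x :* d))))
           refl (- 1#) (sign j) (sign q) (A zero (suc j)) (A (suc q) zero) (D q j))) ⟩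
    sum (λ q → sum (λ j → sign (suc q) * (A (suc q) zero * (sign j * (A zero (suc j) * D q j)))))
      ≈⟨ sum-cong-≋ (λ q →
           *-distribˡ²-sum (sign (suc q)) (A (suc q) zero) (λ j → sign j * (A zero (suc j) * D q j))) ⟨
    sum (λ q → sign (suc q) * (A (suc q) zero * det (minor A (suc q) zero)))
      ∎)
    where
    D : Fin (suc n) → Fin (suc n) → Carrier
    D q j = det (λ i ℓ → A (suc (punchIn q i)) (suc (punchIn j ℓ)))

  det-transpose : ∀ {n} (A : Matrix n n) → det (transpose A) ≈ det A
  det-transpose {zero}  A = refl
  det-transpose {suc n} A = trans
    (sum-cong-≋ λ j → *-congʳ² (sign j) (A j zero) (det-transpose (minor A j zero)))
    (sym (det-expandColumn₀ A))

  swap₀₁ : ∀ {n} → Fin (suc (suc n)) → Fin (suc (suc n))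
  swap₀₁ zero          = suc zero
  swap₀₁ (suc zero)    = zero
  swap₀₁ (suc (suc i)) = suc (suc i)

  private
    minor₀-swap₀₁ : ∀ {n} (i : Fin (suc n)) → swap₀₁ (suc i) ≡ punchIn (suc zero) i
    minor₀-swap₀₁ zero    = ≡.refl
    minor₀-swap₀₁ (suc i) = ≡.refl

    minor₁-swap₀₁ : ∀ {n} (i : Fin (suc n)) → swap₀₁ (punchIn (suc zero) i) ≡ suc i
    minor₁-swap₀₁ zero    = ≡.refl
    minor₁-swap₀₁ (suc i) = ≡.refl

    punchIn-swap₀₁ : ∀ {n} (q : Fin (suc n)) i →
                     swap₀₁ (punchIn (suc (suc q)) i) ≡ punchIn (suc (suc q)) (swap₀₁ i)
    punchIn-swap₀₁ q zero          = ≡.refl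
    punchIn-swap₀₁ q (suc zero)    = ≡.refl
    punchIn-swap₀₁ q (suc (suc i)) = ≡.refl

  -- Along the first column, the terms of the first two rows trade places and hence signs. Deleting
  -- any other row leaves the swap visible in the minor, which is handled by the mutual induction;
  -- there the index `q : Fin n` guarantees that the minor still has two rows.
  det-swap₀₁ : ∀ {n} (A : Matrix (suc (suc n)) (suc (suc n))) → det (A ∘ swap₀₁) ≈ - 1# * det A
  det-minor-swap₀₁ : ∀ {n} (B : Matrix (suc (suc n)) (suc n)) (q : Fin n) →
                     det (B ∘ swap₀₁ ∘ punchIn (suc (suc q))) ≈ - 1# * det (B ∘ punchIn (suc (suc q)))

  det-minor-swap₀₁ {suc n} B q =
    trans (det-congRows B (punchIn-swap₀₁ q)) (det-swap₀₁ (B ∘ punchIn (suc (suc q))))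

  det-swap₀₁ {n} A = begin
    det (A ∘ swap₀₁)
      ≈⟨ det-expandColumn₀ (A ∘ swap₀₁) ⟩
    1# * (y * det (B ∘ swap₀₁ ∘ punchIn zero)) +
      ((- 1# * 1#) * (x * det (B ∘ swap₀₁ ∘ punchIn (suc zero))) +
        sum (λ q → σ q * (e q * det (B ∘ swap₀₁ ∘ punchIn (suc (suc q))))))
      ≈⟨ +-cong (*-congʳ² 1# y (det-congRows B minor₀-swap₀₁))
           (+-cong (*-congʳ² (- 1# * 1#) x (det-congRows B minor₁-swap₀₁))
             (trans (sum-cong-≋ rest) (sym (*-distribˡ-sum (- 1#) R)))) ⟩
    1# * Y + ((- 1# * 1#) * X + - 1# * sum R)
      ≈⟨ solve 4 (λ m X Y R → con 1 :* Y :+ ((m :* con 1) :* X :+ m :* R) := con 1 :* Y :+ (m :* X :+ m :* R))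
           refl (- 1#) X Y (sum R) ⟩
    1# * Y + (- 1# * X + - 1# * sum R)
      -- The semiring solver treats `- 1#` as an atom, so the fact that its square is 1 is inserted
      -- by hand.
      ≈⟨ +-congʳ (*-congʳ -1*-1≈1) ⟨
    (- 1# * - 1#) * Y + (- 1# * X + - 1# * sum R)
      ≈⟨ solve 4 (λ m X Y R → m :* (con 1 :* X :+ ((m :* con 1) :* Y :+ R)) := (m :* m) :* Y :+ (m :* X :+ m :* R))
           refl (- 1#) X Y (sum R) ⟨
    - 1# * (1# * X + ((- 1# * 1#) * Y + sum R))
      ≈⟨ *-congˡ (det-expandColumn₀ A) ⟨
    - 1# * det A
      ∎
    where
    B : Matrix (suc (suc n)) (suc n)
    B i j = A i (suc j)

    x y X Y : Carrier
    x = A zero zero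
    y = A (suc zero) zero
    X = x * det (minor A zero zero)
    Y = y * det (minor A (suc zero) zero)

    σ e R : Vector Carrier n
    σ q = sign (suc (suc q))
    e q = A (suc (suc q)) zero
    R q = σ q * (e q * det (minor A (suc (suc q)) zero))

    rest : ∀ q → σ q * (e q * det (B ∘ swap₀₁ ∘ punchIn (suc (suc q)))) ≈ - 1# * R q
    rest q = trans (*-congʳ² (σ q) (e q) (det-minor-swap₀₁ B q))
      (solve 4 (λ s e m d → s :* (e :* (m :* d)) := m :* (s :* (e :* d)))
         refl (σ q) (e q) (- 1#) (det (minor A (suc (suc q)) zero)))

  toFront : ∀ {n} → Fin (suc n) → Fin (suc n) → Fin (suc n)
  toFront p zero    = p
  toFront p (suc i) = punchIn p i

  toSecond : ∀ {n} → Fin (suc n) → Fin (suc (suc n)) → Fin (suc (suc n))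
  toSecond p zero    = zero
  toSecond p (suc i) = suc (toFront p i)

  -- A row is moved to the front by moving it to second place and then swapping the first two rows.
  -- The move to second place fixes row `zero`, so it acts inside each minor of the defining
  -- expansion, where it is a move to the front again.
  det-toFront  : ∀ {n} p (A : Matrix (suc n) (suc n)) → det (A ∘ toFront p) ≈ sign p * det A
  det-toSecond : ∀ {n} p (A : Matrix (suc (suc n)) (suc (suc n))) → det (A ∘ toSecond p) ≈ sign p * det A

  det-toSecond p A = trans
    (sum-cong-≋ λ j → trans
      (*-congʳ² (sign j) (A zero j) (det-toFront p (minor A zero j)))
      (solve 4 (λ s e t d → s :* (e :* (t :* d)) := t :* (s :* (e :* d)))
         refl (sign j) (A zero j) (sign p) (det (minor A zero j))))
    (sym (*-distribˡ-sum (sign p) (λ j → sign j * (A zero j * det (minor A zero j)))))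

  det-toFront zero A = trans
    (det-congRows A {toFront zero} {λ i → i} λ { zero → ≡.refl ; (suc i) → ≡.refl })
    (sym (*-identityˡ _))
  det-toFront {suc n} (suc p) A = begin
    det (A ∘ toFront (suc p))
      ≈⟨ det-congRows A {toFront (suc p)} {toSecond p ∘ swap₀₁}
           (λ { zero → ≡.refl ; (suc zero) → ≡.refl ; (suc (suc i)) → ≡.refl }) ⟩
    det (A ∘ toSecond p ∘ swap₀₁)
      ≈⟨ det-swap₀₁ (A ∘ toSecond p) ⟩
    - 1# * det (A ∘ toSecond p)
      ≈⟨ *-congˡ (det-toSecond p A) ⟩
    - 1# * (sign p * det A)
      ≈⟨ *-assoc _ _ _ ⟨
    sign (suc p) * det A
      ∎

  -- Column `p` becomes the first row after transposing and `toFront p`, and then the definition of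
  -- `det` applies. The sign stays on the left because absolute values remove it later.
  det-expandColumn : ∀ {n} (A : Matrix (suc n) (suc n)) p →
                     sign p * det A ≈ sum (λ q → sign q * (A q p * det (minor A q p)))
  det-expandColumn A p = begin
    sign p * det A                    ≈⟨ *-congˡ (det-transpose A) ⟨
    sign p * det (transpose A)        ≈⟨ det-toFront p (transpose A) ⟨
    det (transpose A ∘ toFront p)     ≈⟨ sum-cong-≋ (λ q → *-congʳ² (sign q) (A q p) (det-transpose (minor A q p))) ⟩
    sum (λ q → sign q * (A q p * det (minor A q p))) ∎

  det-equalRows₀₁ : ∀ {n} (A : Matrix (suc (suc n)) (suc (suc n))) →
                    (∀ j → A zero j ≈ A (suc zero) j) → det A ≈ 0#
  det-equalRows₀₁ A A₀≈A₁ = x≈-x⇒x≈0 (begin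
    det A             ≈⟨ det-cong {A = A} {A ∘ swap₀₁}
                           (λ { zero → A₀≈A₁ ; (suc zero) j → sym (A₀≈A₁ j) ; (suc (suc i)) j → refl }) ⟩
    det (A ∘ swap₀₁)  ≈⟨ det-swap₀₁ A ⟩
    - 1# * det A      ≈⟨ -1*x≈-x _ ⟩
    - det A           ∎)

  -- The two rows are brought to the first two places, where swapping them changes only the sign.
  -- Once row `p` is in front, row `q` has position `punchOut p≢q` among the others.
  det-equalRows : ∀ {n} (A : Matrix n n) {p q} → p ≢ q → (∀ j → A p j ≈ A q j) → det A ≈ 0#
  det-equalRows {suc zero}    A {zero} {zero} p≢q row≈ = contradiction ≡.refl p≢q
  det-equalRows {suc (suc n)} A {p} {q} p≢q row≈ =
    sign*x≈0⇒x≈0 p (trans (sym (det-toFront p A)) (sign*x≈0⇒x≈0 q′ (begin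
      sign q′ * det (A ∘ toFront p)         ≈⟨ det-toSecond q′ (A ∘ toFront p) ⟨
      det (A ∘ toFront p ∘ toSecond q′)     ≈⟨ det-equalRows₀₁ (A ∘ toFront p ∘ toSecond q′) rows≈ ⟩
      0#                                    ∎)))
    where
    q′ : Fin (suc n)
    q′ = punchOut p≢q

    rows≈ : ∀ j → A p j ≈ A (punchIn p q′) j
    rows≈ j = trans (row≈ j) (reflexive (≡.cong (λ r → A r j) (≡.sym (punchIn-punchOut p≢q))))

-- Index selections and the splitting of an index into half and offset.

Injective≡ : ∀ {m n} → (Fin m → Fin n) → Set
Injective≡ = Injective _≡_ _≡_

selections-injective : ∀ m ℓ → All Injective≡ (selections m ℓ)
selections-injective m       zero    = (λ { {()} }) ∷ []
selections-injective zero    (suc ℓ) = []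
selections-injective (suc m) (suc ℓ) = All.++⁺
  (All.map⁺ (All.map cons-injective (selections-injective m ℓ)))
  (All.map⁺ (All.map suc∘-injective (selections-injective m (suc ℓ))))
  where
  suc∘-injective : ∀ {n} {f : Fin n → Fin m} → Injective≡ f → Injective≡ (suc ∘ f)
  suc∘-injective inj eq = inj (suc-injective eq)

  cons-injective : ∀ {f} → Injective≡ f → Injective≡ (zero ∷ᵛ (suc ∘ f))
  cons-injective inj {zero}  {zero}  _  = ≡.refl
  cons-injective inj {suc i} {suc j} eq = ≡.cong suc (inj (suc-injective eq))

-- The selection of all columns, through which `vecdisc` of the whole matrix enters `hervecdisc`.
-- The listed function agrees with the identity pointwise, which is the form used from here on.
selections-full : ∀ n → Any (λ c → ∀ i → c i ≡ i) (selections n n)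
selections-full zero    = here λ ()
selections-full (suc n) = Any.++⁺ˡ (Any.map⁺ (Any.map
  (λ c≗id → λ { zero → ≡.refl ; (suc i) → ≡.cong suc (c≗id i) }) (selections-full n)))

remQuot-injective : ∀ {n} {i j : Fin (2 ℕ.* n)} →
                    quotient {2} n i ≡ quotient {2} n j → remainder {2} n i ≡ remainder {2} n j → i ≡ j
remQuot-injective {n} {i} {j} eq₁ eq₂ = ≡.trans (≡.sym (combine-remQuot {2} n i))
  (≡.trans (≡.cong₂ combine eq₁ eq₂) (combine-remQuot {2} n j))

-- Entries and minors of the Haar matrices.

module HaarBasis {a} (ℝ : CompleteOrderedField a) where
  open Discrepancy ℝ
  open OrderedFieldProperties ℝ
  open DeterminantProperties ℝ
  open Extrema totalOrder using (max≤v⁺; v≤max⁺)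
  open SemiringSum semiring using (*-distribˡ-sum)
  open RingSolver commutativeSemiring using (solve; _:=_; _:+_; _:*_; con)
  open ≤-Reasoning poset

  side : ∀ k → Fin (2 ℕ.^ suc k) → Fin 2
  side k = quotient {2} (2 ℕ.^ k)

  offset : ∀ k → Fin (2 ℕ.^ suc k) → Fin (2 ℕ.^ k)
  offset k = remainder {2} (2 ℕ.^ k)

  index : ∀ k → Fin 2 → Fin (2 ℕ.^ k) → Fin (2 ℕ.^ suc k)
  index k = combine {2} {2 ℕ.^ k}

  -- `block` matches on `remQuot`, so the decompositions enter as equations. This serves both
  -- arbitrary indices, as in the minors, and indices built by `index`, as in `combination-haar`.
  -- "Coarse" means the left half of the columns, "fine" the right half.
  haar-coarse : ∀ k i j {b i′ j′} →
                remQuot {2} (2 ℕ.^ k) i ≡ (b , i′) → remQuot {2} (2 ℕ.^ k) j ≡ (zero , j′) →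
                haar (suc k) i j ≡ haar k i′ j′
  haar-coarse k i j {zero}     eqᵢ eqⱼ rewrite eqᵢ | eqⱼ = ≡.refl
  haar-coarse k i j {suc zero} eqᵢ eqⱼ rewrite eqᵢ | eqⱼ = ≡.refl

  haar-fine : ∀ k i j {b i′ j′} →
              remQuot {2} (2 ℕ.^ k) i ≡ (b , i′) → remQuot {2} (2 ℕ.^ k) j ≡ (suc zero , j′) →
              haar (suc k) i j ≈ sign b * identity i′ j′
  haar-fine k i j {zero}     eqᵢ eqⱼ rewrite eqᵢ | eqⱼ = sym (*-identityˡ _)
  haar-fine k i j {suc zero} eqᵢ eqⱼ rewrite eqᵢ | eqⱼ = sym (sign₁*x≈-x _)

  identity-diagonal : ∀ {n} {i j : Fin n} → i ≡ j → identity i j ≈ 1#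
  identity-diagonal {i = i} {j} i≡j with i ≟ j
  ... | yes _  = refl
  ... | no i≢j = contradiction i≡j i≢j

  identity-offDiagonal : ∀ {n} {i j : Fin n} → i ≢ j → identity i j ≈ 0#
  identity-offDiagonal {i = i} {j} i≢j with i ≟ j
  ... | yes i≡j = contradiction i≡j i≢j
  ... | no _    = refl

  0≤two^ : ∀ n → 0# ≤ two ^ n
  0≤two^ n = ≤-trans 0≤1 (1≤x^n n 1≤two)

  -- A fine column is nonzero only in rows with the same offset as the column. Side and offset
  -- determine a row and `r` is injective, so each side contributes at most one term; this is where
  -- the factor two comes from.
  det-expandFineColumn :
    ∀ k {ℓ} (r c : Fin (suc ℓ) → Fin (2 ℕ.^ suc k)) → Injective≡ r → ∀ {p} → side k (c p) ≡ suc zero →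
    (∀ q → ∣ det (submatrix (haar (suc k)) (r ∘ punchIn q) (c ∘ punchIn p)) ∣ ≤ two ^ ℓ) →
    ∣ det (submatrix (haar (suc k)) r c) ∣ ≤ two ^ suc ℓ
  det-expandFineColumn k {ℓ} r c r-inj {p} fine minor-bound = begin
    ∣ det M ∣           ≈⟨ ∣sign*x∣≈∣x∣ p (det M) ⟨
    ∣ sign p * det M ∣  ≈⟨ ∣∣-cong (det-expandColumn M p) ⟩
    ∣ sum term ∣        ≤⟨ ∣sum∣-atMostTwo term (side k ∘ r) (0≤two^ ℓ) term-bound two-terms ⟩
    two ^ ℓ + two ^ ℓ   ≈⟨ x+x≈two*x (two ^ ℓ) ⟩
    two ^ suc ℓ         ∎
    where
    M : Matrix (suc ℓ) (suc ℓ)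
    M = submatrix (haar (suc k)) r c

    term : Vector Carrier (suc ℓ)
    term q = sign q * (M q p * det (minor M q p))

    row : Fin (suc ℓ) → Fin (2 ℕ.^ k)
    row = offset k ∘ r

    col : Fin (2 ℕ.^ k)
    col = offset k (c p)

    M-entry : ∀ q → M q p ≈ sign (side k (r q)) * identity (row q) col
    M-entry q = haar-fine k (r q) (c p) ≡.refl (≡.cong (_, col) fine)

    term≈0 : ∀ {q} → row q ≢ col → term q ≈ 0#
    term≈0 {q} row≢col = begin-equality
      sign q * (M q p * d)  ≈⟨ *-congˡ (*-congʳ (trans (M-entry q)
                                 (trans (*-congˡ (identity-offDiagonal row≢col)) (zeroʳ _)))) ⟩
      sign q * (0# * d)     ≈⟨ *-congˡ (zeroˡ d) ⟩
      sign q * 0#           ≈⟨ zeroʳ (sign q) ⟩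
      0#                    ∎
      where
      d : Carrier
      d = det (minor M q p)

    term-bound : ∀ q → ∣ term q ∣ ≤ two ^ ℓ
    term-bound q with row q ≟ col
    ... | no row≢col  = ≤-trans (x≈0⇒∣x∣≤0 (term≈0 row≢col)) (0≤two^ ℓ)
    ... | yes row≡col = begin
      ∣ sign q * (M q p * d) ∣             ≈⟨ ∣sign*x∣≈∣x∣ q (M q p * d) ⟩
      ∣ M q p * d ∣                        ≈⟨ ∣∣-cong (*-congʳ (trans (M-entry q)
                                                (trans (*-congˡ (identity-diagonal row≡col)) (*-identityʳ _)))) ⟩
      ∣ sign (side k (r q)) * d ∣             ≈⟨ ∣sign*x∣≈∣x∣ (side k (r q)) d ⟩
      ∣ d ∣                                ≤⟨ minor-bound q ⟩
      two ^ ℓ                              ∎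
      where
      d : Carrier
      d = det (minor M q p)

    two-terms : ∀ {q q′} → q ≢ q′ → side k (r q) ≡ side k (r q′) → term q ≈ 0# ⊎ term q′ ≈ 0#
    two-terms {q} {q′} q≢q′ same with row q ≟ col | row q′ ≟ col
    ... | no row≢col | _           = inj₁ (term≈0 row≢col)
    ... | yes _      | no row≢col  = inj₂ (term≈0 row≢col)
    ... | yes eq     | yes eq′     =
      contradiction (r-inj (remQuot-injective same (≡.trans eq (≡.sym eq′)))) q≢q′

  -- Two rows with the same offset agree on the coarse columns, so either the determinant vanishes or it
  -- is a minor of the previous Haar matrix.
  det-coarseColumns :
    ∀ k {ℓ} (r c : Fin ℓ → Fin (2 ℕ.^ suc k)) →
    (∀ i j → haar (suc k) (r i) (c j) ≈ haar k (offset k (r i)) (offset k (c j))) →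
    (Injective≡ (offset k ∘ r) → ∣ det (submatrix (haar k) (offset k ∘ r) (offset k ∘ c)) ∣ ≤ two ^ ℓ) →
    ∣ det (submatrix (haar (suc k)) r c) ∣ ≤ two ^ ℓ
  det-coarseColumns k {ℓ} r c coarse-entry bound
    with any? (λ p → any? (λ q → ¬? (p ≟ q) ×-dec (offset k (r p) ≟ offset k (r q))))
  ... | yes (p , q , p≢q , same) = begin
    ∣ det (submatrix (haar (suc k)) r c) ∣  ≤⟨ x≈0⇒∣x∣≤0 (trans (det-cong coarse-entry) (det-equalRows _ p≢q rows≈)) ⟩
    0#                                      ≤⟨ 0≤two^ ℓ ⟩
    two ^ ℓ                                 ∎
    where
    rows≈ : ∀ j → haar k (offset k (r p)) (offset k (c j)) ≈ haar k (offset k (r q)) (offset k (c j))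
    rows≈ j = reflexive (≡.cong (λ i → haar k i (offset k (c j))) same)
  ... | no distinct = ≤-trans (≤-reflexive (∣∣-cong (det-cong coarse-entry))) (bound offset-injective)
    where
    offset-injective : Injective≡ (offset k ∘ r)
    offset-injective {p} {q} eq with p ≟ q
    ... | yes p≡q = p≡q
    ... | no p≢q  = contradiction (p , q , p≢q , eq) distinct

  -- A fine column reduces `ℓ` with `k` fixed; if all columns are coarse, `k` drops with `ℓ` fixed.
  -- In the latter case all columns have the same side, so their offsets remain distinct.
  haar-det-bound : ∀ k {ℓ} (r c : Fin ℓ → Fin (2 ℕ.^ k)) → Injective≡ r → Injective≡ c →
                   ∣ det (submatrix (haar k) r c) ∣ ≤ two ^ ℓ
  haar-det-bound k    {zero}       r c r-inj c-inj = 0≤x⇒∣x∣≤x 0≤1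
  haar-det-bound zero {suc zero}   r c r-inj c-inj = begin
    ∣ 1# * (1# * 1#) + 0# ∣  ≈⟨ ∣∣-cong (solve 0 (con 1 :* (con 1 :* con 1) :+ con 0 := con 1) refl) ⟩
    ∣ 1# ∣                   ≤⟨ 0≤x⇒∣x∣≤x 0≤1 ⟩
    1#                       ≤⟨ 1≤x^n 1 1≤two ⟩
    two ^ 1                  ∎
  haar-det-bound zero {suc (suc ℓ)} r c r-inj c-inj with r zero in eq₀ | r (suc zero) in eq₁
  -- `haar zero` has one row, so two distinct rows cannot be selected.
  ... | zero | zero = contradiction (r-inj (≡.trans eq₀ (≡.sym eq₁))) λ ()
  haar-det-bound (suc k) {suc ℓ} r c r-inj c-inj with any? (λ p → side k (c p) ≟ suc zero)
  ... | yes (p , fine) = det-expandFineColumn k r c r-inj fine λ q →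
    haar-det-bound (suc k) (r ∘ punchIn q) (c ∘ punchIn p)
      (λ eq → punchIn-injective q _ _ (r-inj eq)) (λ eq → punchIn-injective p _ _ (c-inj eq))
  ... | no ¬fine = det-coarseColumns k r c coarse-entry λ row-injective →
    haar-det-bound k (offset k ∘ r) (offset k ∘ c) row-injective
      λ {p} {q} eq → c-inj (remQuot-injective {2 ℕ.^ k} (≡.trans (coarse p) (≡.sym (coarse q))) eq)
    where
    coarse : ∀ j → side k (c j) ≡ zero
    coarse j with side k (c j) in eq
    ... | zero     = ≡.refl
    ... | suc zero = contradiction (j , eq) ¬fine

    coarse-entry : ∀ i j → haar (suc k) (r i) (c j) ≈ haar k (offset k (r i)) (offset k (c j))
    coarse-entry i j = reflexive (haar-coarse k (r i) (c j) ≡.refl (≡.cong (_, offset k (c j)) (coarse j)))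

  detlb≤ : ∀ {m n} (A : Matrix m n) {b} → 0# ≤ b →
           (∀ {ℓ} {r : Fin (suc ℓ) → Fin m} {c : Fin (suc ℓ) → Fin n} → Injective≡ r → Injective≡ c →
             root (suc ℓ) ∣ det (submatrix A r c) ∣ ≤ b) → detlb A ≤ b
  detlb≤ {m} {n} A {b} 0≤b root≤b =
    max≤v⁺ 0≤b (All.concat⁺ (All.map⁺ {f = roots} (All.universal all-roots (List.upTo (m ℕ.⊓ n)))))
    where
    roots : ℕ → List.List Carrier
    roots ℓ = List.cartesianProductWith (λ r c → root (suc ℓ) ∣ det (submatrix A r c) ∣)
      (selections m (suc ℓ)) (selections n (suc ℓ))

    all-roots : ∀ ℓ → All (_≤ b) (roots ℓ)
    all-roots ℓ = All.cartesianProductWith⁺ (≡.setoid _) (≡.setoid _) _ _ _ λ r∈ c∈ →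
      root≤b (All.lookup (selections-injective m (suc ℓ)) r∈) (All.lookup (selections-injective n (suc ℓ)) c∈)

  detlb-haar≤2 : ∀ k → detlb (haar k) ≤ two
  detlb-haar≤2 k = detlb≤ (haar k) (0≤fromℕ 2) λ {ℓ} {r} {c} r-inj c-inj →
    root≤ ℓ 1≤two (haar-det-bound k r c r-inj c-inj)

  -- Long row combinations and the lower bound on the discrepancy.

  sumsq : ∀ {d} → Vector Carrier d → Carrier
  sumsq x = sum (λ t → x t * x t)

  sumsq-cong : ∀ {d} {x y : Vector Carrier d} → (∀ t → x t ≈ y t) → sumsq x ≈ sumsq y
  sumsq-cong x≈y = sum-cong-≋ λ t → *-cong (x≈y t) (x≈y t)

  0≤sumsq : ∀ {d} (x : Vector Carrier d) → 0# ≤ sumsq x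
  0≤sumsq {zero}  x = ≤-refl
  0≤sumsq {suc d} x = ≤-trans (0≤x*x (x zero)) (x≤x+y (0≤sumsq (x ∘ suc)))

  sumsq-+ : ∀ {d} σ (x y : Vector Carrier d) → let xy = sum (λ t → x t * y t) in
            sumsq (λ t → x t + σ * y t) ≈ sumsq x + (σ * σ) * sumsq y + σ * (xy + xy)
  sumsq-+ {zero}  σ x y = solve 1 (λ σ → con 0 := con 0 :+ (σ :* σ) :* con 0 :+ σ :* (con 0 :+ con 0)) refl σ
  sumsq-+ {suc d} σ x y = trans (+-congˡ (sumsq-+ σ (x ∘ suc) (y ∘ suc)))
    (solve 6 (λ σ x y X Y P →
        (x :+ σ :* y) :* (x :+ σ :* y) :+ (X :+ (σ :* σ) :* Y :+ σ :* (P :+ P))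
          := (x :* x :+ X) :+ (σ :* σ) :* (y :* y :+ Y) :+ σ :* ((x :* y :+ P) :+ (x :* y :+ P)))
      refl σ (x zero) (y zero) (sumsq (x ∘ suc)) (sumsq (y ∘ suc)) (sum (λ t → x (suc t) * y (suc t))))

  -- The sign is chosen to make the cross term, twice the inner product, nonnegative.
  parallelogram : ∀ {d} (x y : Vector Carrier d) →
                  ∃ λ (b : Fin 2) → sumsq x + sumsq y ≤ sumsq (λ t → x t + sign b * y t)
  parallelogram x y = b , (begin
    sumsq x + sumsq y                                             ≈⟨ +-congˡ (*-identityˡ _) ⟨
    sumsq x + 1# * sumsq y                                        ≈⟨ +-congˡ (*-congʳ (sign*sign≈1 b)) ⟨
    sumsq x + (sign b * sign b) * sumsq y                         ≤⟨ x≤x+y 0≤cross ⟩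
    sumsq x + (sign b * sign b) * sumsq y + sign b * (xy + xy)    ≈⟨ sumsq-+ (sign b) x y ⟨
    sumsq (λ t → x t + sign b * y t)                              ∎)
    where
    xy : Carrier
    xy = sum (λ t → x t * y t)

    choice : ∃ λ (b : Fin 2) → 0# ≤ sign b * (xy + xy)
    choice with total 0# (xy + xy)
    ... | inj₁ 0≤ = zero , ≤-trans 0≤ (≤-reflexive (sym (*-identityˡ _)))
    ... | inj₂ ≤0 = suc zero , ≤-trans (x≤0⇒0≤-x ≤0) (≤-reflexive (sym (sign₁*x≈-x _)))

    b : Fin 2
    b = proj₁ choice

    0≤cross : 0# ≤ sign b * (xy + xy)
    0≤cross = proj₂ choice

  sum-splitAt : ∀ m {n} (f : Vector Carrier (m ℕ.+ n)) →
                sum f ≈ sum (λ i → f (i ↑ˡ n)) + sum (λ i → f (m ↑ʳ i))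
  sum-splitAt zero    f = sym (+-identityˡ _)
  sum-splitAt (suc m) f = trans (+-congˡ (sum-splitAt m (f ∘ suc))) (sym (+-assoc _ _ _))

  sum-combine : ∀ n (f : Vector Carrier (2 ℕ.* n)) →
                sum f ≈ sum (λ i → f (combine {2} {n} zero i)) + sum (λ i → f (combine {2} {n} (suc zero) i))
  sum-combine n f = trans (sum-splitAt n f)
    -- `2 ℕ.* n` unfolds to `n + (n + 0)`, so an empty sum is left over.
    (+-congˡ (trans (sum-splitAt n (λ i → f (n ↑ʳ i))) (+-identityʳ _)))

  sum-identity : ∀ {n} (i : Fin n) (f : Vector Carrier n) → sum (λ j → identity i j * f j) ≈ f i
  sum-identity zero    f = trans
    (+-cong (*-identityˡ (f zero)) (sum-zero λ j → zeroˡ (f (suc j)))) (+-identityʳ (f zero))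
  sum-identity (suc i) f = trans (+-cong (zeroˡ (f zero)) (sum-identity i (f ∘ suc))) (+-identityˡ (f (suc i)))

  -- The identity block singles out one fine vector. The two rows with offset `i` therefore share
  -- the coarse part and differ only in the sign of that vector.
  combination-haar :
    ∀ k {d} (v : Fin (2 ℕ.^ suc k) → Vector Carrier d) b i t →
    combination (haar (suc k) (index k b i)) v t
      ≈ combination (haar k i) (v ∘ index k zero) t + sign b * v (index k (suc zero) i) t
  combination-haar k v b i t = trans (sum-combine (2 ℕ.^ k) (λ j → haar (suc k) (index k b i) j * v j t))
    (+-cong
      (sum-cong-≋ λ j → *-congʳ {x = v (index k zero j) t} (reflexive (coarse-entry j)))
      (begin-equality
        sum (λ j → haar (suc k) (index k b i) (index k (suc zero) j) * v (index k (suc zero) j) t)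
          ≈⟨ sum-cong-≋ (λ j → trans (*-congʳ (fine-entry j)) (*-assoc (sign b) (identity i j) _)) ⟩
        sum (λ j → sign b * (identity i j * v (index k (suc zero) j) t))
          ≈⟨ *-distribˡ-sum (sign b) (λ j → identity i j * v (index k (suc zero) j) t) ⟨
        sign b * sum (λ j → identity i j * v (index k (suc zero) j) t)
          ≈⟨ *-congˡ (sum-identity i (λ j → v (index k (suc zero) j) t)) ⟩
        sign b * v (index k (suc zero) i) t
          ∎))
    where
    coarse-entry : ∀ j → haar (suc k) (index k b i) (index k zero j) ≡ haar k i j
    coarse-entry j = haar-coarse k (index k b i) (index k zero j)
      (remQuot-combine b i) (remQuot-combine {2} zero j)

    fine-entry : ∀ j → haar (suc k) (index k b i) (index k (suc zero) j) ≈ sign b * identity i j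
    fine-entry j = haar-fine k (index k b i) (index k (suc zero) j)
      (remQuot-combine b i) (remQuot-combine {2} (suc zero) j)

  -- The dimension `d` is independent of `k` because the induction halves the number of vectors
  -- while they stay in the same space. Each level adds the squared length of one fine vector, which
  -- is at least 1.
  haar-longRow : ∀ k {d} (v : Fin (2 ℕ.^ k) → Vector Carrier d) → (∀ i → 1# ≤ sumsq (v i)) →
                 ∃ λ j → fromℕ (suc k) ≤ sumsq (combination (haar k j) v)
  haar-longRow zero v 1≤v = zero , (begin
    1# + 0#                                 ≈⟨ +-identityʳ 1# ⟩
    1#                                      ≤⟨ 1≤v zero ⟩
    sumsq (v zero)                          ≈⟨ sumsq-cong {x = combination (haar zero zero) v}
                                                 (λ t → trans (+-identityʳ _) (*-identityˡ (v zero t))) ⟨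
    sumsq (combination (haar zero zero) v)  ∎)
  haar-longRow (suc k) v 1≤v =
    let i , long = haar-longRow k (v ∘ index k zero) (1≤v ∘ index k zero)
        x = combination (haar k i) (v ∘ index k zero)
        y = v (index k (suc zero) i)
        b , longer = parallelogram x y
    in index k b i , (begin
      1# + fromℕ (suc k)                                ≈⟨ +-comm 1# _ ⟩
      fromℕ (suc k) + 1#                                ≤⟨ +-mono-≤ long (1≤v (index k (suc zero) i)) ⟩
      sumsq x + sumsq y                                 ≤⟨ longer ⟩
      sumsq (λ t → x t + sign b * y t)                  ≈⟨ sumsq-cong {x = combination (haar (suc k) (index k b i)) v}
                                                             (combination-haar k v b i) ⟨
      sumsq (combination (haar (suc k) (index k b i)) v)  ∎)

  -- `inf` is the supremum of the lower bounds, so it suffices that `r` is one of them. Unit vectors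
  -- enter through `√x≈1⇒1≤x`, in the form that `haar-longRow` accepts.
  ≤vecdisc : ∀ {m n} (A : Matrix m n) {r} →
             (∀ v → (∀ i → 1# ≤ sumsq (v i)) → ∃ λ j → r ≤ ‖ combination (A j) v ‖) → r ≤ vecdisc A
  ≤vecdisc A {r} long = sup-upper (LowerBound (VecdiscSet A)) _ _ λ {s} → lower {s}
    where
    lower : LowerBound (VecdiscSet A) r
    lower (v , unit , s≈) =
      let j , r≤ = long v (λ i → √x≈1⇒1≤x (0≤sumsq (v i)) (unit i)) in
      ≤-trans (v≤max⁺ 0# _ (inj₂ (Any.tabulate⁺ j r≤))) (≤-reflexive (sym s≈))

  ≤hervecdisc : ∀ {m n} .{{_ : NonZero n}} (A : Matrix m n) {r} →
                (∀ c → (∀ i → c i ≡ i) → r ≤ vecdisc (columns A c)) → r ≤ hervecdisc A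
  ≤hervecdisc {n = suc n} A r≤ = v≤max⁺ 0# _ (inj₂
    (Any.concatMap⁺ (λ ℓ → List.map (λ c → vecdisc (columns A c)) (selections (suc n) (suc ℓ)))
      -- The list entry `ℓ` stands for `suc ℓ` columns, so the full set sits at the last entry `n`
      -- of `upTo (suc n)`.
      (Any.applyUpTo⁺ (λ ℓ → ℓ) (Any.map⁺ (Any.map (λ {c} → r≤ c) (selections-full (suc n)))) (ℕ.n<1+n n))))

  √[1+k]≤hervecdisc : ∀ k → √ (fromℕ (suc k)) ≤ hervecdisc (haar k)
  √[1+k]≤hervecdisc k = ≤hervecdisc {{ℕ.m^n≢0 2 k}} (haar k) λ c c≗id →
    ≤vecdisc (columns (haar k) c) λ v 1≤v →
      let j , long = haar-longRow k v 1≤v in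
      j , √-mono-≤ (≤-trans long (≤-reflexive (sumsq-cong {x = combination (haar k j) v} λ t →
        sum-cong-≋ λ i → *-congʳ (reflexive (≡.cong (haar k j) (≡.sym (c≗id i)))))))

theorem3 : ∀ {a} (ℝ : CompleteOrderedField a) → let open Discrepancy ℝ in
    ∃ λ (c : Carrier) → 0# < c ×
    (∀ (k : ℕ) → 1 ℕ.≤ k → c * √ (log (fromℕ (2 ℕ.^ k))) * detlb (haar k) ≤ hervecdisc (haar k))
theorem3 ℝ = half , 0<half , bound
  where
  open Discrepancy ℝ
  open OrderedFieldProperties ℝ
  open HaarBasis ℝ
  open ≤-Reasoning poset

  bound : ∀ k → 1 ℕ.≤ k → half * √ (log (fromℕ (2 ℕ.^ k))) * detlb (haar k) ≤ hervecdisc (haar k)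
  bound k 1≤k = begin
    half * L * detlb (haar k)   ≈⟨ *-comm _ _ ⟩
    -- The bound 2 on `detlb` is cancelled exactly by the constant `half`.
    detlb (haar k) * (half * L) ≤⟨ *-monoʳ-≤-nonNeg (*-nonNeg 0≤half (0≤√ _)) (detlb-haar≤2 k) ⟩
    two * (half * L)            ≈⟨ *-assoc two half L ⟨
    two * half * L              ≈⟨ *-congʳ two*half≈1 ⟩
    1# * L                      ≈⟨ *-identityˡ L ⟩
    L                           ≤⟨ √-mono-≤ (log2^k≤k k {{ℕ.>-nonZero 1≤k}}) ⟩
    √ (fromℕ k)                 ≤⟨ √-mono-≤ (≤-trans (x≤x+y 0≤1) (≤-reflexive (+-comm (fromℕ k) 1#))) ⟩
    √ (fromℕ (suc k))           ≤⟨ √[1+k]≤hervecdisc k ⟩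
    hervecdisc (haar k)         ∎
    where
    L : Carrier
    L = √ (log (fromℕ (2 ℕ.^ k)))
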